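{- For every $\varepsilon>0$ there exists $N$ such that for every finite group $R$ of order $r\ge N$ which is neither a generalized dicyclic group nor an abelian group of exponent greater than $2$, the proportion of inverse-closed subsets $S$ of $R$ (among all inverse-closed subsets of $R$) such that $\mathrm{N}_{\mathrm{Aut}(\Gamma(R,S))}(R)>R$ is at most $\varepsilon$. In other words, this proportion goes to $0$ as $r\to\infty$.
   Context: A subset $S$ of a group $R$ is inverse-closed if $S^{ -1}:=\{s^{ -1}\mid s\in S\}=S$. The Cayley (di)graph $\Gamma(R,S)$ has vertex set $R$, and $(g,h)$ is an arc iff $hg^{ -1}\in S$; it is undirected when $S$ is inverse-closed. $R$ acts regularly on $\Gamma(R,S)$ by right multiplication, and $R$ is identified with this subgroup of $\mathrm{Aut}(\Gamma(R,S))$; $\mathrm{N}_{\mathrm{Aut}(\Gamma(R,S))}(R)$ denotes its normalizer in $\mathrm{Aut}(\Gamma(R,S))$. A group is generalized dicyclic if it is isomorphic to $\mathrm{Dic}(A,y,x)=\langle A,x\mid x^2=y,\ x^{ -1}ax=a^{ -1}\ \forall a\in A\rangle$ for some abelian group $A$ of even order and exponent greater than $2$ and some involution $y\in A$. -}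

module Defs where

open import Level using (0ℓ)
open import Data.Nat using (ℕ; _+_)
open import Data.Fin using (Fin)
open import Data.Bool using (Bool; true; false)
open import Data.Product using (Σ; _×_; _,_; ∃; ∃-syntax)
open import Data.List using (List)
open import Data.List.Membership.Propositional using () renaming (_∈_ to _∈ᴸ_)
open import Data.List.Relation.Unary.All using (All)
open import Data.List.Relation.Unary.Unique.Propositional using (Unique)
open import Data.Fin.Subset using (Subset; _∈_)
open import Data.Fin.Permutation using (Permutation′; _⟨$⟩ʳ_)
open import Relation.Binary.PropositionalEquality using (_≡_)
open import Relation.Nullary using (¬_)
open import Algebra.Structures using (IsGroup; IsAbelianGroup)
open import Algebra.Bundles.Raw using (RawGroup)
import Algebra.Morphism.Structures as MS

record FinGroup (n : ℕ) : Set where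
  infixl 7 _∙_
  field
    _∙_     : Fin n → Fin n → Fin n
    e       : Fin n
    _⁻¹     : Fin n → Fin n
    isGroup : IsGroup _≡_ _∙_ e _⁻¹

record FinAbGroup (m : ℕ) : Set where
  infixl 7 _∙_
  field
    _∙_   : Fin m → Fin m → Fin m
    e     : Fin m
    _⁻¹   : Fin m → Fin m
    isAbelianGroup : IsAbelianGroup _≡_ _∙_ e _⁻¹

-- Generalized dicyclic groups Dic(A,y,x) = ⟨A, x | x² = y, x⁻¹ a x = a⁻¹⟩,
-- realised via their normal form: every element is uniquely a·x^b with
-- a ∈ A, b ∈ {0,1}; the pair (a , b) stands for a·x^b.
-- Multiplication: a·(c) = ac ; a·(c x) = (ac) x ; (a x)(c) = (a c⁻¹) x ;
-- (a x)(c x) = a c⁻¹ y.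

module _ {m : ℕ} (A : FinAbGroup m) (y : Fin m) where
  open FinAbGroup A

  dicMul : Fin m × Bool → Fin m × Bool → Fin m × Bool
  dicMul (a , false) (c , false) = (a ∙ c , false)
  dicMul (a , false) (c , true)  = (a ∙ c , true)
  dicMul (a , true)  (c , false) = (a ∙ (c ⁻¹) , true)
  dicMul (a , true)  (c , true)  = (a ∙ (c ⁻¹) ∙ y , false)

  dicOne : Fin m × Bool
  dicOne = (e , false)

  -- inverse: (a)⁻¹ = a⁻¹ ; (a x)⁻¹ = x⁻¹ a⁻¹ = y x a⁻¹ = y a x = (a y) x
  dicInv : Fin m × Bool → Fin m × Bool
  dicInv (a , false) = (a ⁻¹ , false)
  dicInv (a , true)  = (a ∙ y , true)

Even : ℕ → Set
Even m = ∃[ k ] m ≡ k + k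

Dic : ∀ {m} → FinAbGroup m → Fin m → RawGroup 0ℓ 0ℓ
Dic {m} A y = record
  { Carrier = Fin m × Bool ; _≈_ = _≡_
  ; _∙_ = dicMul A y ; ε = dicOne A y ; _⁻¹ = dicInv A y }

rawOf : ∀ {n} → FinGroup n → RawGroup 0ℓ 0ℓ
rawOf {n} R = record
  { Carrier = Fin n ; _≈_ = _≡_
  ; _∙_ = FinGroup._∙_ R ; ε = FinGroup.e R ; _⁻¹ = FinGroup._⁻¹ R }

IsGenDicyclic : ∀ {n} → FinGroup n → Set
IsGenDicyclic {n} R =
  Σ ℕ λ m → Σ (FinAbGroup m) λ A → Σ (Fin m) λ y →
    Even m
    × (∃[ a ] ¬ (FinAbGroup._∙_ A a a ≡ FinAbGroup.e A))
    × ¬ (y ≡ FinAbGroup.e A) × (FinAbGroup._∙_ A y y ≡ FinAbGroup.e A)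
    × Σ (Fin n → Fin m × Bool) λ f →
        MS.GroupMorphisms.IsGroupIsomorphism (rawOf R) (Dic A y) f

IsAbelianExpGt2 : ∀ {n} → FinGroup n → Set
IsAbelianExpGt2 R =
  (∀ g h → g ∙ h ≡ h ∙ g) × (∃[ g ] ¬ (g ∙ g ≡ e))
  where open FinGroup R

module _ {n : ℕ} (R : FinGroup n) where
  open FinGroup R

  InverseClosed : Subset n → Set
  InverseClosed S =
    (∀ s → s ∈ S → (s ⁻¹) ∈ S)
    × (∀ x → x ∈ S → ∃[ s ] (s ∈ S × x ≡ s ⁻¹))

  Arc : Subset n → Fin n → Fin n → Set
  Arc S g h = (h ∙ (g ⁻¹)) ∈ S

  IsAut : Subset n → Permutation′ n → Set
  IsAut S φ = ∀ g h → (Arc S g h → Arc S (φ ⟨$⟩ʳ g) (φ ⟨$⟩ʳ h))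
                    × (Arc S (φ ⟨$⟩ʳ g) (φ ⟨$⟩ʳ h) → Arc S g h)

  -- φ lies in (the right regular copy of) R : φ = ρ_g : x ↦ x g
  InR : Permutation′ n → Set
  InR φ = ∃[ g ] (∀ x → φ ⟨$⟩ʳ x ≡ x ∙ g)

  -- φ normalises R : φ R φ⁻¹ = R, i.e. for each g there is h with
  -- φ ∘ ρ_g = ρ_h ∘ φ, and for each h there is g with the same.
  Normalises : Permutation′ n → Set
  Normalises φ =
    (∀ g → ∃[ h ] (∀ x → φ ⟨$⟩ʳ (x ∙ g) ≡ (φ ⟨$⟩ʳ x) ∙ h))
    × (∀ h → ∃[ g ] (∀ x → φ ⟨$⟩ʳ (x ∙ g) ≡ (φ ⟨$⟩ʳ x) ∙ h))

  -- N_{Aut(Γ(R,S))}(R) > R  (R is always contained in the normaliser, so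
  -- strict containment means some element of the normaliser is not in R)
  NormalizerLarger : Subset n → Set
  NormalizerLarger S =
    ∃[ φ ] (IsAut S φ × Normalises φ × ¬ InR φ)

  -- Counting without decidability:
  -- a list enumerating all inverse-closed subsets exactly once
  EnumeratesInvClosed : List (Subset n) → Set
  EnumeratesInvClosed L =
    Unique L × All InverseClosed L × (∀ S → InverseClosed S → S ∈ᴸ L)

  BadList : List (Subset n) → Set
  BadList L = Unique L × All (λ S → InverseClosed S × NormalizerLarger S) L

{-# OPTIONS --safe #-}

-- An element of the normaliser outside R yields, after composing with a right translation, a
-- nontrivial automorphism φ of R with φ(S) = S. Call x moved by φ if φ(x) is neither x nor x⁻¹.
--
-- Suppose fewer than n/12 of the n elements of R are moved. If Fix φ is small, then almost every
-- element is inverted; elements inverted by φ whose product is inverted commute, so R is abelian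
-- and φ is inversion. If Fix φ is large, then, choosing generic points to avoid the moved
-- elements, Fix φ is abelian and every element outside it is inverted by φ and inverts Fix φ
-- under conjugation; so either Fix φ has exponent at most 2 and φ inverts all of R, or Fix φ has
-- index 2 and R is generalised dicyclic.
--
-- Otherwise n/48 moved elements can be chosen such that toggling S on their inverse pairs
-- independently destroys φ-invariance in a recoverable way: a given φ preserves at most a
-- 2^(-n/48) fraction of the inverse-closed sets. An automorphism is determined by at most
-- 1 + log₂ n values, so a union bound over n^(1 + log₂ n) automorphisms finishes the proof.

module Submission where

open import Defs
open import Data.Nat as ℕ using (ℕ; zero; suc; _≥_; z≤n; s≤s)
import Data.Nat.Properties as ℕ
open import Data.Bool using (Bool; true; false; not; if_then_else_)
open import Data.Fin using (Fin; zero; suc)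
open import Data.Fin.Subset using (Subset)
open import Data.List using (List; []; _∷_; _++_; map; concatMap; filter; length; lookup; allFin)
open import Data.List.Properties using (length-map; length-++; length-tabulate; length-filter)
open import Data.List.Membership.Propositional using (_∈_; _∉_; find)
open import Data.List.Membership.Propositional.Properties
open import Data.List.Relation.Unary.Any as Any using (here; there; index)
import Data.List.Relation.Unary.Any.Properties as Any
open import Data.List.Relation.Unary.All as All using (All; []; _∷_)
import Data.List.Relation.Unary.All.Properties as All
open import Data.List.Relation.Unary.AllPairs using (AllPairs; []; _∷_)
import Data.List.Relation.Unary.AllPairs.Properties as AllPairs
open import Data.List.Relation.Unary.Unique.Propositional using (Unique)
import Data.List.Relation.Unary.Unique.Propositional.Properties as Unique
open import Data.Product using (∃; ∃-syntax; _×_; _,_; proj₁; proj₂)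
open import Data.Sum using (_⊎_; inj₁; inj₂; [_,_]′)
open import Function using (_∘_; _↪_; RightInverse; mk↪)
open import Relation.Binary.Definitions using (DecidableEquality)
open import Relation.Binary.PropositionalEquality
open import Relation.Nullary using (¬_; Dec; yes; no; does; contradiction; ¬?)
open import Relation.Nullary.Decidable
  using (_⊎-dec_; _×-dec_; _→-dec_; decidable-stable; dec-true; dec-false)
open import Relation.Unary using (Pred; Decidable)

-- Counting with duplicate-free lists.

module Lists where
  open import Level using (Level)
  open import Data.Nat using (_+_; _*_; _≤_; _<_)
  open import Data.Nat.Properties
  import Data.Fin as F
  import Data.Fin.Properties as Fin
  import Data.List.Relation.Binary.Sublist.Propositional.Properties as Sublist

  private variable
    a b p : Level
    A : Set a
    B : Set b

  length-allFin : ∀ n → length (allFin n) ≡ n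
  length-allFin n = length-tabulate (λ i → i)

  lookup-injective : {xs : List A} → Unique xs → ∀ i j → lookup xs i ≡ lookup xs j → i ≡ j
  lookup-injective (_  ∷ _)  zero    zero    _  = refl
  lookup-injective (x∉ ∷ _)  zero    (suc j) eq = contradiction eq (All.lookup x∉ (∈-lookup j))
  lookup-injective (x∉ ∷ _)  (suc i) zero    eq = contradiction (sym eq) (All.lookup x∉ (∈-lookup i))
  lookup-injective (_  ∷ u)  (suc i) (suc j) eq = cong suc (lookup-injective u i j eq)

  -- Each position in `xs` is sent to a position in `ys` holding the same element; as `xs` has no
  -- repetitions, this map between finite index sets is injective.
  unique-⊆⇒length-≤ : {xs ys : List A} → Unique xs → (∀ {x} → x ∈ xs → x ∈ ys) →
                      length xs ≤ length ys
  unique-⊆⇒length-≤ {xs = xs} {ys} u sub = Fin.injective⇒≤ {f = λ i → index (sub (∈-lookup i))}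
    λ {i} {j} eq → lookup-injective u i j
      (trans (Any.lookup-index (sub (∈-lookup i)))
        (trans (cong (lookup ys) eq) (sym (Any.lookup-index (sub (∈-lookup j))))))

  unique-map-⊆⇒length-≤ : {f : A → B} → (∀ {x y} → f x ≡ f y → x ≡ y) →
                          {xs : List A} {ys : List B} → Unique xs →
                          (∀ {x} → x ∈ xs → f x ∈ ys) → length xs ≤ length ys
  unique-map-⊆⇒length-≤ {f = f} inj {xs} {ys} u sub = begin
    length xs          ≡⟨ length-map f xs ⟨
    length (map f xs)  ≤⟨ unique-⊆⇒length-≤ (Unique.map⁺ inj u) sub′ ⟩
    length ys          ∎
    where
    open ≤-Reasoning
    sub′ : ∀ {y} → y ∈ map f xs → y ∈ ys
    sub′ y∈ with ∈-map⁻ f y∈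
    ... | _ , x∈ , refl = sub x∈

  module _ (_≟_ : DecidableEquality A) where
    open import Data.List.Membership.DecPropositional _≟_ using (_∈?_)

    ∃-∉ : {xs : List A} (ys : List A) → Unique xs → length ys < length xs →
          ∃[ x ] x ∈ xs × x ∉ ys
    ∃-∉ {xs} ys u ys<xs with All.all? (_∈? ys) xs
    ... | yes all = contradiction (unique-⊆⇒length-≤ u (All.lookup all)) (<⇒≱ ys<xs)
    ... | no ¬all = find (All.¬All⇒Any¬ (_∈? ys) xs ¬all)

  length-filter-¬ : {P : Pred A p} (P? : Decidable P) (xs : List A) →
                    length (filter P? xs) + length (filter (¬? ∘ P?) xs) ≡ length xs
  length-filter-¬ P? [] = refl
  length-filter-¬ P? (x ∷ xs) with P? x
  ... | yes _ = cong suc (length-filter-¬ P? xs)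
  ... | no  _ = trans (+-suc _ _) (cong suc (length-filter-¬ P? xs))

  length-concatMap-map : (fs : List (A → B)) (xs : List A) →
                         length (concatMap (λ f → map f xs) fs) ≡ length fs * length xs
  length-concatMap-map []       xs = refl
  length-concatMap-map (f ∷ fs) xs = begin
    length (map f xs ++ concatMap (λ g → map g xs) fs)          ≡⟨ length-++ (map f xs) ⟩
    length (map f xs) + length (concatMap (λ g → map g xs) fs)  ≡⟨ cong₂ _+_ (length-map f xs) (length-concatMap-map fs xs) ⟩
    length xs + length fs * length xs                           ∎
    where open ≡-Reasoning

  module _ (_≟_ : DecidableEquality B) (c : A → B) where

    fibre : B → List A → List A
    fibre v = filter (λ x → c x ≟ v)

    -- Induction on `vs` splits off the fibre over its head. What remains is a sublist, so its
    -- fibres satisfy the same bound. The factor `k` carries a bound of the form D/k on each fibre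
    -- without division.
    length-≤-fibres : ∀ k D (vs : List B) (xs : List A) → All (λ x → c x ∈ vs) xs →
                      (∀ v → length (fibre v xs) * k ≤ D) → length xs * k ≤ length vs * D
    length-≤-fibres k D []       []       _         _ = z≤n
    length-≤-fibres k D []       (x ∷ xs) (() ∷ _)  _
    length-≤-fibres k D (v ∷ vs) xs       cs        h = begin
      length xs * k                               ≡⟨ cong (_* k) (length-filter-¬ (λ x → c x ≟ v) xs) ⟨
      (length (fibre v xs) + length rest) * k     ≡⟨ *-distribʳ-+ k (length (fibre v xs)) _ ⟩
      length (fibre v xs) * k + length rest * k   ≤⟨ +-mono-≤ (h v) (length-≤-fibres k D vs rest rest∈ rest-h) ⟩
      D + length vs * D                           ∎
      where
      open ≤-Reasoning
      rest : List A
      rest = filter (λ x → ¬? (c x ≟ v)) xs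
      rest∈ : All (λ x → c x ∈ vs) rest
      rest∈ = All.tabulate λ x∈ → let x∈xs , cx≢v = ∈-filter⁻ (λ x → ¬? (c x ≟ v)) {xs = xs} x∈ in
        drop-here cx≢v (All.lookup cs x∈xs)
        where
        drop-here : ∀ {u} → u ≢ v → u ∈ v ∷ vs → u ∈ vs
        drop-here u≢v (here u≡v)  = contradiction u≡v u≢v
        drop-here u≢v (there u∈)  = u∈
      rest-h : ∀ w → length (fibre w rest) * k ≤ D
      rest-h w = ≤-trans (*-monoˡ-≤ k (Sublist.length-mono-≤
        (Sublist.filter⁺ (λ x → c x ≟ w) (λ x → c x ≟ w) (λ { refl p → p })
          (Sublist.filter-⊆ (λ x → ¬? (c x ≟ v)) xs)))) (h w)

  -- A fixed-point-free involution exchanges the points that it raises with those that it lowers, so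
  -- the two classes have equal size.
  Even-involution : ∀ {m} (σ : Fin m → Fin m) → (∀ i → σ (σ i) ≡ i) → (∀ i → σ i ≢ i) →
                    ∃[ k ] m ≡ k + k
  Even-involution {m} σ σσ σ≢ = length up , (begin
      m                             ≡⟨ length-allFin m ⟨
      length (allFin m)             ≡⟨ length-filter-¬ up? (allFin m) ⟨
      length up + length down       ≡⟨ cong (length up +_) (≤-antisym down≤up up≤down) ⟩
      length up + length up         ∎)
    where
    open ≡-Reasoning
    up? : Decidable (λ i → i F.< σ i)
    up? i = i Fin.<? σ i
    up down : List (Fin m)
    up   = filter up? (allFin m)
    down = filter (¬? ∘ up?) (allFin m)
    σ-inj : ∀ {i j} → σ i ≡ σ j → i ≡ j
    σ-inj {i} {j} eq = trans (sym (σσ i)) (trans (cong σ eq) (σσ j))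
    up≤down : length up ≤ length down
    up≤down = unique-map-⊆⇒length-≤ σ-inj (Unique.filter⁺ up? (Unique.allFin⁺ m)) λ {i} i∈ →
      let i<σi = proj₂ (∈-filter⁻ up? {xs = allFin m} i∈) in
      ∈-filter⁺ (¬? ∘ up?) (∈-allFin (σ i)) λ σi<σσi →
        Fin.<-asym i<σi (subst (σ i F.<_) (σσ i) σi<σσi)
    down≤up : length down ≤ length up
    down≤up = unique-map-⊆⇒length-≤ σ-inj (Unique.filter⁺ (¬? ∘ up?) (Unique.allFin⁺ m)) λ {i} i∈ →
      let i≮σi = proj₂ (∈-filter⁻ (¬? ∘ up?) {xs = allFin m} i∈) in
      ∈-filter⁺ up? (∈-allFin (σ i)) (subst (σ i F.<_) (sym (σσ i))
        (Fin.≤∧≢⇒< (≮⇒≥ i≮σi) (σ≢ i)))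

  module _ (_≟_ : DecidableEquality A) where

    abstract
      -- Union bound: for each `t`, the points that `t` sends into `ys` all lie in the image of `ys`
      -- under `from t`, so at most |ts|·|ys| elements of `xs` are excluded. This is how generic
      -- points are chosen below.
      ∃-avoiding : {xs : List A} (ys : List A) (ts : List (A ↪ A)) → Unique xs →
                   length ts * length ys < length xs →
                   ∃[ x ] x ∈ xs × All (λ t → RightInverse.to t x ∉ ys) ts
      ∃-avoiding {xs} ys ts u small =
        let x , x∈ , x∉ = ∃-∉ _≟_ preimages u (subst (_< length xs) (sym length-preimages) small)
        in  x , x∈ , All.tabulate λ {t} t∈ tx∈ → x∉ (∈-concatMap⁺ _ {xs = map RightInverse.from ts}
              (Any.map⁺ (Any.map (λ { refl → subst (_∈ map (RightInverse.from t) ys)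
                (RightInverse.strictlyInverseʳ t x) (∈-map⁺ (RightInverse.from t) tx∈) }) t∈)))
        where
        preimages : List A
        preimages = concatMap (λ f → map f ys) (map RightInverse.from ts)
        length-preimages : length preimages ≡ length ts * length ys
        length-preimages = trans (length-concatMap-map (map RightInverse.from ts) ys)
                                 (cong (_* length ys) (length-map RightInverse.from ts))

open Lists

-- Automorphisms that fix or invert most elements.

module GroupAutomorphisms where
  open import Level using (0ℓ)
  open import Algebra.Bundles using (Group)
  open import Algebra.Structures using (IsGroup)
  import Algebra.Properties.Group as GroupProperties
  import Algebra.Morphism.GroupMonomorphism as GroupMonomorphism
  import Algebra.Morphism.Structures as Morphism
  open import Data.Nat using (_+_; _*_; _≤_; _<_; _≤?_)
  open import Data.Nat.Properties hiding (_≟_)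
  open import Data.Fin.Properties using (_≟_; all?; ¬∀⟶∃¬)
  open import Function.Construct.Identity using (↪-id)
  open import Function.Construct.Composition using (_↪-∘_)

  group : ∀ {n} → FinGroup n → Group 0ℓ 0ℓ
  group {n} R = record { Carrier = Fin n ; isGroup = FinGroup.isGroup R }

  Homomorphic : ∀ {n} → FinGroup n → (Fin n → Fin n) → Set
  Homomorphic R φ = ∀ x y → φ (x ∙ y) ≡ φ x ∙ φ y
    where open FinGroup R

  module Endomorphism {n} (R : FinGroup n) (φ : Fin n → Fin n) (homo : Homomorphic R φ) where
    open FinGroup R
    open IsGroup isGroup using (assoc; identityˡ; identityʳ; inverseˡ; inverseʳ)
    open GroupProperties (group R)
    open ≡-Reasoning

    ε-homo : φ e ≡ e
    ε-homo = identityˡ-unique (φ e) (φ e) (trans (sym (homo e e)) (cong φ (identityˡ e)))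

    ⁻¹-homo : ∀ x → φ (x ⁻¹) ≡ (φ x) ⁻¹
    ⁻¹-homo x = inverseˡ-unique _ _ (trans (sym (homo _ _)) (trans (cong φ (inverseˡ x)) ε-homo))

    Fixed Inverted Moved : Fin n → Set
    Fixed    x = φ x ≡ x
    Inverted x = φ x ≡ x ⁻¹
    Moved    x = ¬ (Fixed x ⊎ Inverted x)

    fixed? : Decidable Fixed
    fixed? x = φ x ≟ x

    moved? : Decidable Moved
    moved? x = ¬? (fixed? x ⊎-dec (φ x ≟ x ⁻¹))

    fixedList movedList : List (Fin n)
    fixedList = filter fixed? (allFin n)
    movedList = filter moved? (allFin n)

    ∈-fixedList : ∀ {x} → Fixed x → x ∈ fixedList
    ∈-fixedList {x} = ∈-filter⁺ fixed? (∈-allFin x)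

    fixedList-fixed : ∀ {x} → x ∈ fixedList → Fixed x
    fixedList-fixed x∈ = proj₂ (∈-filter⁻ fixed? {xs = allFin n} x∈)

    unique-fixedList : Unique fixedList
    unique-fixedList = Unique.filter⁺ fixed? (Unique.allFin⁺ n)

    unmoved-unfixed⇒inverted : ∀ {x} → x ∉ movedList → ¬ Fixed x → Inverted x
    unmoved-unfixed⇒inverted {x} x∉ x≢ with moved? x
    ... | yes mx = contradiction (∈-filter⁺ moved? (∈-allFin x) mx) x∉
    ... | no ¬mx with decidable-stable (fixed? x ⊎-dec (φ x ≟ x ⁻¹)) ¬mx
    ...   | inj₁ fx = contradiction fx x≢
    ...   | inj₂ ix = ix

    fixed-∙ : ∀ {x y} → Fixed x → Fixed y → Fixed (x ∙ y)
    fixed-∙ fx fy = trans (homo _ _) (cong₂ _∙_ fx fy)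

    fixed-⁻¹ : ∀ {x} → Fixed x → Fixed (x ⁻¹)
    fixed-⁻¹ fx = trans (⁻¹-homo _) (cong _⁻¹ fx)

    unfixed-∙ʳ : ∀ {x a} → ¬ Fixed x → Fixed a → ¬ Fixed (x ∙ a)
    unfixed-∙ʳ {x} {a} x≢ fa fxa = x≢ (∙-cancelʳ a _ _ (begin
      φ x ∙ a    ≡⟨ cong (φ x ∙_) fa ⟨
      φ x ∙ φ a  ≡⟨ homo x a ⟨
      φ (x ∙ a)  ≡⟨ fxa ⟩
      x ∙ a      ∎))

    unfixed-∙ˡ : ∀ {a x} → Fixed a → ¬ Fixed x → ¬ Fixed (a ∙ x)
    unfixed-∙ˡ {a} {x} fa x≢ fax =
      x≢ (subst Fixed (\\-leftDividesʳ a x) (fixed-∙ (fixed-⁻¹ fa) fax))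

    inverted-comm : ∀ {x y} → Inverted x → Inverted y → Inverted (x ∙ y) → x ∙ y ≡ y ∙ x
    inverted-comm {x} {y} ix iy ixy = ⁻¹-injective (begin
      (x ∙ y) ⁻¹   ≡⟨ ixy ⟨
      φ (x ∙ y)    ≡⟨ homo x y ⟩
      φ x ∙ φ y    ≡⟨ cong₂ _∙_ ix iy ⟩
      x ⁻¹ ∙ y ⁻¹  ≡⟨ ⁻¹-anti-homo-∙ y x ⟨
      (y ∙ x) ⁻¹   ∎)

    inverted⇒abelian : (∀ x → Inverted x) → ∃[ g ] ¬ Fixed g → IsAbelianExpGt2 R
    inverted⇒abelian inv (g , g≢) =
      (λ x y → inverted-comm (inv x) (inv y) (inv (x ∙ y))) ,
      (g , λ gg → g≢ (trans (inv g) (sym (inverseˡ-unique g g gg))))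

    leftMul rightMul : Fin n → Fin n ↪ Fin n
    leftMul  a = mk↪ {to = a ∙_} {from = a ⁻¹ ∙_} λ { refl → \\-leftDividesʳ a _ }
    rightMul a = mk↪ {to = _∙ a} {from = _∙ a ⁻¹} λ { refl → //-rightDividesʳ a _ }

    choose : {xs : List (Fin n)} (ys : List (Fin n)) (ts : List (Fin n ↪ Fin n)) → Unique xs →
             length ts * length ys < length xs →
             ∃[ x ] x ∈ xs × All (λ t → RightInverse.to t x ∉ ys) ts
    choose = ∃-avoiding _≟_

    -- Any `y` is a quotient z w⁻¹ of two inverted elements with `w` central, and inversion is
    -- multiplicative on such a quotient.
    inverted-everywhere : (ys : List (Fin n)) → (∀ {x} → x ∉ ys → Inverted x) →
                          4 * length ys < n → ∀ x → Inverted x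
    inverted-everywhere ys inv 4ys<n y = y-inverted
      where
      4ys<all : 4 * length ys < length (allFin n)
      4ys<all = subst (4 * length ys <_) (sym (length-allFin n)) 4ys<n

      -- Four points must avoid `ys`: z, xz, w = y⁻¹z and xw. Then x commutes with z and with w,
      -- hence with y = z w⁻¹.
      central : ∀ {x} → Inverted x → ∀ y → x ∙ y ≡ y ∙ x
      central {x} ix y with choose ys (↪-id _ ∷ leftMul x ∷ leftMul (y ⁻¹) ∷ (leftMul x ↪-∘ leftMul (y ⁻¹)) ∷ [])
                                   (Unique.allFin⁺ n) 4ys<all
      ... | z , _ , z∉ ∷ xz∉ ∷ w∉ ∷ xw∉ ∷ [] = ∙-cancelʳ w _ _ (begin
        (x ∙ y) ∙ w  ≡⟨ assoc x y w ⟩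
        x ∙ (y ∙ w)  ≡⟨ cong (x ∙_) (\\-leftDividesˡ y z) ⟩
        x ∙ z        ≡⟨ inverted-comm ix (inv z∉) (inv xz∉) ⟩
        z ∙ x        ≡⟨ cong (_∙ x) (\\-leftDividesˡ y z) ⟨
        (y ∙ w) ∙ x  ≡⟨ assoc y w x ⟩
        y ∙ (w ∙ x)  ≡⟨ cong (y ∙_) (inverted-comm ix (inv w∉) (inv xw∉)) ⟨
        y ∙ (x ∙ w)  ≡⟨ assoc y x w ⟨
        (y ∙ x) ∙ w  ∎)
        where
        w : Fin n
        w = y ⁻¹ ∙ z

      y-inverted : Inverted y
      y-inverted with choose ys (↪-id _ ∷ leftMul (y ⁻¹) ∷ []) (Unique.allFin⁺ n)
                             (≤-<-trans (*-monoˡ-≤ (length ys) {2} {4} (s≤s (s≤s z≤n))) 4ys<all)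
      ... | z , _ , z∉ ∷ w∉ ∷ [] = ∙-cancelʳ (w ⁻¹) _ _ (begin
        φ y ∙ w ⁻¹   ≡⟨ cong (φ y ∙_) (inv w∉) ⟨
        φ y ∙ φ w    ≡⟨ homo y w ⟨
        φ (y ∙ w)    ≡⟨ cong φ (\\-leftDividesˡ y z) ⟩
        φ z          ≡⟨ inv z∉ ⟩
        z ⁻¹         ≡⟨ cong _⁻¹ (\\-leftDividesˡ y z) ⟨
        (y ∙ w) ⁻¹   ≡⟨ cong _⁻¹ (central (inv w∉) y) ⟨
        (w ∙ y) ⁻¹   ≡⟨ ⁻¹-anti-homo-∙ w y ⟩
        y ⁻¹ ∙ w ⁻¹  ∎)
        where
        w : Fin n
        w = y ⁻¹ ∙ z

    -- The conclusion is x⁻¹ a x = a⁻¹ with the last factor moved to the right: conjugation by `x`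
    -- inverts `a`.
    inverts : ∀ {x a} → Fixed a → Inverted x → Inverted (x ∙ a) → x ⁻¹ ∙ a ≡ a ⁻¹ ∙ x ⁻¹
    inverts {x} {a} fa ix ixa = begin
      x ⁻¹ ∙ a     ≡⟨ cong₂ _∙_ ix fa ⟨
      φ x ∙ φ a    ≡⟨ homo x a ⟨
      φ (x ∙ a)    ≡⟨ ixa ⟩
      (x ∙ a) ⁻¹   ≡⟨ ⁻¹-anti-homo-∙ x a ⟩
      a ⁻¹ ∙ x ⁻¹  ∎

    -- The fixed subgroup and its complement when few elements are moved.

    module _ {g : Fin n} (g-unfixed : ¬ Fixed g) (8B<n : 8 * length movedList < n) where

      -- Eight conditions, four on z and the same four on gz: if the generic z happens to be fixed,
      -- then gz is not and replaces it.
      unfixed-avoiding : ∀ a b → ∃[ x ] ¬ Fixed x × x ∉ movedList × x ∙ a ∉ movedList ×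
                                        x ∙ b ∉ movedList × x ∙ (a ∙ b) ∉ movedList
      unfixed-avoiding a b
        with choose movedList
               (↪-id _ ∷ rightMul a ∷ rightMul b ∷ rightMul (a ∙ b) ∷
                leftMul g ∷ (rightMul a ↪-∘ leftMul g) ∷ (rightMul b ↪-∘ leftMul g) ∷
                (rightMul (a ∙ b) ↪-∘ leftMul g) ∷ [])
               (Unique.allFin⁺ n) (subst (8 * length movedList <_) (sym (length-allFin n)) 8B<n)
      ... | z , _ , p₁ ∷ p₂ ∷ p₃ ∷ p₄ ∷ q₁ ∷ q₂ ∷ q₃ ∷ q₄ ∷ [] with fixed? z
      ...   | no  z≢ = z , z≢ , p₁ , p₂ , p₃ , p₄
      ...   | yes fz = g ∙ z , unfixed-∙ʳ g-unfixed fz , q₁ , q₂ , q₃ , q₄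

      -- Conjugation by a generic unfixed `x` inverts each of a, b and ab. Conjugation is
      -- multiplicative, so (ab)⁻¹ = a⁻¹b⁻¹ = (ba)⁻¹.
      fixed-comm : ∀ {a b} → Fixed a → Fixed b → a ∙ b ≡ b ∙ a
      fixed-comm {a} {b} fa fb with unfixed-avoiding a b
      ... | x , x≢ , x∉ , xa∉ , xb∉ , xab∉ = ⁻¹-injective (∙-cancelʳ (x ⁻¹) _ _ (begin
        (a ∙ b) ⁻¹ ∙ x ⁻¹     ≡⟨ inv fab xab∉ ⟨
        x ⁻¹ ∙ (a ∙ b)        ≡⟨ assoc (x ⁻¹) a b ⟨
        (x ⁻¹ ∙ a) ∙ b        ≡⟨ cong (_∙ b) (inv fa xa∉) ⟩
        (a ⁻¹ ∙ x ⁻¹) ∙ b     ≡⟨ assoc (a ⁻¹) (x ⁻¹) b ⟩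
        a ⁻¹ ∙ (x ⁻¹ ∙ b)     ≡⟨ cong (a ⁻¹ ∙_) (inv fb xb∉) ⟩
        a ⁻¹ ∙ (b ⁻¹ ∙ x ⁻¹)  ≡⟨ assoc (a ⁻¹) (b ⁻¹) (x ⁻¹) ⟨
        (a ⁻¹ ∙ b ⁻¹) ∙ x ⁻¹  ≡⟨ cong (_∙ x ⁻¹) (⁻¹-anti-homo-∙ b a) ⟨
        (b ∙ a) ⁻¹ ∙ x ⁻¹     ∎))
        where
        fab : Fixed (a ∙ b)
        fab = fixed-∙ fa fb
        inv : ∀ {c} → Fixed c → x ∙ c ∉ movedList → x ⁻¹ ∙ c ≡ c ⁻¹ ∙ x ⁻¹
        inv fc xc∉ = inverts fc (unmoved-unfixed⇒inverted x∉ x≢)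
                                (unmoved-unfixed⇒inverted xc∉ (unfixed-∙ʳ x≢ fc))

      module _ (2B<F : 2 * length movedList < length fixedList) where

        -- Removes genericity of `x`: for a suitable fixed `h`, both xh and xha are unmoved and
        -- unfixed, so xh inverts `a`. Since `h` commutes with the fixed element `a`, so does x.
        unfixed-inverts : ∀ {x a} → ¬ Fixed x → Fixed a → x ⁻¹ ∙ a ≡ a ⁻¹ ∙ x ⁻¹
        unfixed-inverts {x} {a} x≢ fa
          with choose movedList (leftMul x ∷ (rightMul a ↪-∘ leftMul x) ∷ []) unique-fixedList 2B<F
        ... | h , h∈ , xh∉ ∷ xha∉ ∷ [] = ∙-cancelˡ (h ⁻¹) _ _ (begin
          h ⁻¹ ∙ (x ⁻¹ ∙ a)     ≡⟨ assoc (h ⁻¹) (x ⁻¹) a ⟨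
          (h ⁻¹ ∙ x ⁻¹) ∙ a     ≡⟨ cong (_∙ a) (⁻¹-anti-homo-∙ x h) ⟨
          (x ∙ h) ⁻¹ ∙ a        ≡⟨ inverts fa (unmoved-unfixed⇒inverted xh∉ xh≢)
                                             (unmoved-unfixed⇒inverted xha∉ (unfixed-∙ʳ xh≢ fa)) ⟩
          a ⁻¹ ∙ (x ∙ h) ⁻¹     ≡⟨ cong (a ⁻¹ ∙_) (⁻¹-anti-homo-∙ x h) ⟩
          a ⁻¹ ∙ (h ⁻¹ ∙ x ⁻¹)  ≡⟨ assoc (a ⁻¹) (h ⁻¹) (x ⁻¹) ⟨
          (a ⁻¹ ∙ h ⁻¹) ∙ x ⁻¹  ≡⟨ cong (_∙ x ⁻¹) (fixed-comm (fixed-⁻¹ fa) (fixed-⁻¹ fh)) ⟩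
          (h ⁻¹ ∙ a ⁻¹) ∙ x ⁻¹  ≡⟨ assoc (h ⁻¹) (a ⁻¹) (x ⁻¹) ⟩
          h ⁻¹ ∙ (a ⁻¹ ∙ x ⁻¹)  ∎)
          where
          fh : Fixed h
          fh = fixedList-fixed h∈
          xh≢ : ¬ Fixed (x ∙ h)
          xh≢ = unfixed-∙ʳ x≢ fh

        -- Again `x` is shifted by a fixed `h` with xh inverted; then φ(x)h = h⁻¹x⁻¹ = x⁻¹h, and `h`
        -- cancels.
        unfixed⇒inverted : ∀ {x} → ¬ Fixed x → Inverted x
        unfixed⇒inverted {x} x≢
          with choose movedList (leftMul x ∷ []) unique-fixedList
                 (≤-<-trans (*-monoˡ-≤ (length movedList) {1} {2} (s≤s z≤n)) 2B<F)
        ... | h , h∈ , xh∉ ∷ [] = ∙-cancelʳ h _ _ (begin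
          φ x ∙ h      ≡⟨ cong (φ x ∙_) fh ⟨
          φ x ∙ φ h    ≡⟨ homo x h ⟨
          φ (x ∙ h)    ≡⟨ unmoved-unfixed⇒inverted xh∉ (unfixed-∙ʳ x≢ fh) ⟩
          (x ∙ h) ⁻¹   ≡⟨ ⁻¹-anti-homo-∙ x h ⟩
          h ⁻¹ ∙ x ⁻¹  ≡⟨ unfixed-inverts x≢ fh ⟨
          x ⁻¹ ∙ h     ∎)
          where
          fh : Fixed h
          fh = fixedList-fixed h∈

    -- Generalised dicyclic structure from an abelian fixed subgroup of index two.

    module _ (comm : ∀ {a b} → Fixed a → Fixed b → a ∙ b ≡ b ∙ a)
             (inverted : ∀ {x} → ¬ Fixed x → Inverted x)
             (inverts-fixed : ∀ {x a} → ¬ Fixed x → Fixed a → x ⁻¹ ∙ a ≡ a ⁻¹ ∙ x ⁻¹)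
             {g : Fin n} (g-unfixed : ¬ Fixed g)
             {a₀ : Fin n} (a₀-fixed : Fixed a₀) (a₀²≢e : ¬ (a₀ ∙ a₀ ≡ e)) where

      -- This says that the fixed subgroup has index 2. If xy were unfixed, it would invert `a₀`
      -- under conjugation; as a product of two elements inverting `a₀` it also centralises `a₀`, so
      -- `a₀` would equal its inverse.
      unfixed-∙ : ∀ {x y} → ¬ Fixed x → ¬ Fixed y → Fixed (x ∙ y)
      unfixed-∙ {x} {y} x≢ y≢ with fixed? (x ∙ y)
      ... | yes fxy = fxy
      ... | no xy≢ = contradiction (trans (cong (a₀ ∙_) a₀≡a₀⁻¹) (inverseʳ a₀)) a₀²≢e
        where
        a₀≡a₀⁻¹ : a₀ ≡ a₀ ⁻¹
        a₀≡a₀⁻¹ = ∙-cancelʳ ((x ∙ y) ⁻¹) _ _ (begin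
          a₀ ∙ (x ∙ y) ⁻¹          ≡⟨ cong (a₀ ∙_) (⁻¹-anti-homo-∙ x y) ⟩
          a₀ ∙ (y ⁻¹ ∙ x ⁻¹)       ≡⟨ assoc a₀ (y ⁻¹) (x ⁻¹) ⟨
          (a₀ ∙ y ⁻¹) ∙ x ⁻¹       ≡⟨ cong (λ z → (z ∙ y ⁻¹) ∙ x ⁻¹) (⁻¹-involutive a₀) ⟨
          (a₀ ⁻¹ ⁻¹ ∙ y ⁻¹) ∙ x ⁻¹ ≡⟨ cong (_∙ x ⁻¹) (inverts-fixed y≢ (fixed-⁻¹ a₀-fixed)) ⟨
          (y ⁻¹ ∙ a₀ ⁻¹) ∙ x ⁻¹    ≡⟨ assoc (y ⁻¹) (a₀ ⁻¹) (x ⁻¹) ⟩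
          y ⁻¹ ∙ (a₀ ⁻¹ ∙ x ⁻¹)    ≡⟨ cong (y ⁻¹ ∙_) (inverts-fixed x≢ a₀-fixed) ⟨
          y ⁻¹ ∙ (x ⁻¹ ∙ a₀)       ≡⟨ assoc (y ⁻¹) (x ⁻¹) a₀ ⟨
          (y ⁻¹ ∙ x ⁻¹) ∙ a₀       ≡⟨ cong (_∙ a₀) (⁻¹-anti-homo-∙ x y) ⟨
          (x ∙ y) ⁻¹ ∙ a₀          ≡⟨ inverts-fixed xy≢ a₀-fixed ⟩
          a₀ ⁻¹ ∙ (x ∙ y) ⁻¹       ∎)

      g∙fixed : ∀ {a} → Fixed a → g ∙ a ≡ a ⁻¹ ∙ g
      g∙fixed {a} fa = ⁻¹-injective (begin
        (g ∙ a) ⁻¹         ≡⟨ ⁻¹-anti-homo-∙ g a ⟩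
        a ⁻¹ ∙ g ⁻¹        ≡⟨ inverts-fixed g-unfixed fa ⟨
        g ⁻¹ ∙ a           ≡⟨ cong (g ⁻¹ ∙_) (⁻¹-involutive a) ⟨
        g ⁻¹ ∙ a ⁻¹ ⁻¹     ≡⟨ ⁻¹-anti-homo-∙ (a ⁻¹) g ⟨
        (a ⁻¹ ∙ g) ⁻¹      ∎)

      g²-fixed : Fixed (g ∙ g)
      g²-fixed = unfixed-∙ g-unfixed g-unfixed

      g²≢e : ¬ (g ∙ g ≡ e)
      g²≢e gg = g-unfixed (trans (inverted g-unfixed) (sym (inverseˡ-unique g g gg)))

      -- The square of `g` is fixed, and it is also inverted because `g` is, so it equals its own
      -- inverse. It will serve as the involution `y` of the dicyclic group.
      g⁴≡e : (g ∙ g) ∙ (g ∙ g) ≡ e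
      g⁴≡e = trans (cong ((g ∙ g) ∙_) (begin
        g ∙ g        ≡⟨ g²-fixed ⟨
        φ (g ∙ g)    ≡⟨ homo g g ⟩
        φ g ∙ φ g    ≡⟨ cong₂ _∙_ (inverted g-unfixed) (inverted g-unfixed) ⟩
        g ⁻¹ ∙ g ⁻¹  ≡⟨ ⁻¹-anti-homo-∙ g g ⟨
        (g ∙ g) ⁻¹   ∎)) (inverseʳ (g ∙ g))

      private
        m : ℕ
        m = length fixedList

        el : Fin m → Fin n
        el = lookup fixedList

        el-fixed : ∀ i → Fixed (el i)
        el-fixed i = fixedList-fixed (∈-lookup i)

        el-injective : ∀ {i j} → el i ≡ el j → i ≡ j
        el-injective {i} {j} = lookup-injective unique-fixedList i j

        abstract
          idx : ∀ {a} → Fixed a → Fin m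
          idx fa = index (∈-fixedList fa)

          el-idx : ∀ {a} (fa : Fixed a) → el (idx fa) ≡ a
          el-idx fa = sym (Any.lookup-index (∈-fixedList fa))

        _∙′_ : Fin m → Fin m → Fin m
        i ∙′ j = idx (fixed-∙ (el-fixed i) (el-fixed j))

        _⁻¹′ : Fin m → Fin m
        i ⁻¹′ = idx (fixed-⁻¹ (el-fixed i))

        e′ : Fin m
        e′ = idx ε-homo

        -- The fixed subgroup is modelled on the positions of `fixedList`; through the embedding
        -- `el` it inherits the group laws of `R`.
        el-isMonomorphism : Morphism.GroupMorphisms.IsGroupMonomorphism
          (record { Carrier = Fin m ; _≈_ = _≡_ ; _∙_ = _∙′_ ; ε = e′ ; _⁻¹ = _⁻¹′ }) (rawOf R) el
        el-isMonomorphism = record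
          { isGroupHomomorphism = record
            { isMonoidHomomorphism = record
              { isMagmaHomomorphism = record
                { isRelHomomorphism = record { cong = cong el }
                ; homo              = λ _ _ → el-idx _
                }
              ; ε-homo = el-idx _
              }
            ; ⁻¹-homo = λ _ → el-idx _
            }
          ; injective = el-injective
          }

        A : FinAbGroup m
        A = record
          { _∙_ = _∙′_ ; e = e′ ; _⁻¹ = _⁻¹′
          ; isAbelianGroup = record
            { isGroup = GroupMonomorphism.isGroup el-isMonomorphism isGroup
            ; comm    = λ i j → el-injective (begin
                el (i ∙′ j)   ≡⟨ el-idx _ ⟩
                el i ∙ el j   ≡⟨ comm (el-fixed i) (el-fixed j) ⟩
                el j ∙ el i   ≡⟨ el-idx _ ⟨
                el (j ∙′ i)   ∎)
            }
          }

        y : Fin m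
        y = idx g²-fixed

        el-y : el y ≡ g ∙ g
        el-y = el-idx g²-fixed

        y² : y ∙′ y ≡ e′
        y² = el-injective (begin
          el (y ∙′ y)        ≡⟨ el-idx _ ⟩
          el y ∙ el y        ≡⟨ cong₂ _∙_ el-y el-y ⟩
          (g ∙ g) ∙ (g ∙ g)  ≡⟨ g⁴≡e ⟩
          e                  ≡⟨ el-idx _ ⟨
          el e′              ∎)

        y≢e : ¬ (y ≡ e′)
        y≢e y≡e = g²≢e (trans (sym el-y) (trans (cong el y≡e) (el-idx _)))

        -- Translation by the involution `y` is a fixed-point-free involution of the fixed subgroup.
        m-even : Even m
        m-even = Even-involution (_∙′ y)
          (λ i → el-injective (begin
            el ((i ∙′ y) ∙′ y)    ≡⟨ el-idx _ ⟩
            el (i ∙′ y) ∙ el y    ≡⟨ cong (_∙ el y) (el-idx _) ⟩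
            (el i ∙ el y) ∙ el y  ≡⟨ assoc _ _ _ ⟩
            el i ∙ (el y ∙ el y)  ≡⟨ cong (el i ∙_) (cong₂ _∙_ el-y el-y) ⟩
            el i ∙ ((g ∙ g) ∙ (g ∙ g)) ≡⟨ cong (el i ∙_) g⁴≡e ⟩
            el i ∙ e              ≡⟨ identityʳ _ ⟩
            el i                  ∎))
          (λ i iy≡i → y≢e (el-injective (trans
            (identityʳ-unique (el i) (el y) (trans (sym (el-idx _)) (cong el iy≡i)))
            (sym (el-idx _)))))

        A-exponent>2 : ∃[ a ] ¬ (a ∙′ a ≡ e′)
        A-exponent>2 = idx a₀-fixed , λ aa≡e → a₀²≢e (begin
          a₀ ∙ a₀                            ≡⟨ cong₂ _∙_ (el-idx a₀-fixed) (el-idx a₀-fixed) ⟨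
          el (idx a₀-fixed) ∙ el (idx a₀-fixed) ≡⟨ el-idx _ ⟨
          el (idx a₀-fixed ∙′ idx a₀-fixed)  ≡⟨ cong el aa≡e ⟩
          el e′                              ≡⟨ el-idx _ ⟩
          e                                  ∎)

        -- The normal form of Dic(A,y,x) evaluated in `R`, with `g` in the role of x. Being
        -- explicit, this direction is the one for which the laws are computed; those of `ψ⁻¹`
        -- follow by injectivity.
        ψ : Fin m × Bool → Fin n
        ψ (a , false) = el a
        ψ (a , true)  = el a ∙ g

        ψ-injective : ∀ p q → ψ p ≡ ψ q → p ≡ q
        ψ-injective (a , false) (c , false) eq = cong (_, false) (el-injective eq)
        ψ-injective (a , true)  (c , true)  eq = cong (_, true) (el-injective (∙-cancelʳ g _ _ eq))
        ψ-injective (a , false) (c , true)  eq =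
          contradiction (subst Fixed eq (el-fixed a)) (unfixed-∙ˡ (el-fixed c) g-unfixed)
        ψ-injective p@(_ , true) q@(_ , false) eq = sym (ψ-injective q p (sym eq))

        ψ-homo : ∀ p q → ψ (dicMul A y p q) ≡ ψ p ∙ ψ q
        ψ-homo (a , false) (c , false) = el-idx _
        ψ-homo (a , false) (c , true)  = trans (cong (_∙ g) (el-idx _)) (assoc _ _ _)
        ψ-homo (a , true)  (c , false) = begin
          el (a ∙′ (c ⁻¹′)) ∙ g    ≡⟨ cong (_∙ g) (trans (el-idx _) (cong (el a ∙_) (el-idx _))) ⟩
          (el a ∙ el c ⁻¹) ∙ g     ≡⟨ assoc _ _ _ ⟩
          el a ∙ (el c ⁻¹ ∙ g)     ≡⟨ cong (el a ∙_) (g∙fixed (el-fixed c)) ⟨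
          el a ∙ (g ∙ el c)        ≡⟨ assoc _ _ _ ⟨
          (el a ∙ g) ∙ el c        ∎
        ψ-homo (a , true)  (c , true)  = begin
          el ((a ∙′ (c ⁻¹′)) ∙′ y)       ≡⟨ el-idx _ ⟩
          el (a ∙′ (c ⁻¹′)) ∙ el y       ≡⟨ cong₂ _∙_ (trans (el-idx _) (cong (el a ∙_) (el-idx _))) el-y ⟩
          (el a ∙ el c ⁻¹) ∙ (g ∙ g)     ≡⟨ assoc _ _ _ ⟨
          ((el a ∙ el c ⁻¹) ∙ g) ∙ g     ≡⟨ cong (_∙ g) (assoc _ _ _) ⟩
          (el a ∙ (el c ⁻¹ ∙ g)) ∙ g     ≡⟨ cong (λ z → (el a ∙ z) ∙ g) (g∙fixed (el-fixed c)) ⟨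
          (el a ∙ (g ∙ el c)) ∙ g        ≡⟨ cong (_∙ g) (assoc _ _ _) ⟨
          ((el a ∙ g) ∙ el c) ∙ g        ≡⟨ assoc _ _ _ ⟩
          (el a ∙ g) ∙ (el c ∙ g)        ∎

        ψ-inv : ∀ p → ψ (dicInv A y p) ≡ ψ p ⁻¹
        ψ-inv (a , false) = el-idx _
        ψ-inv (a , true)  = begin
          el (a ∙′ y) ∙ g           ≡⟨ cong (_∙ g) (trans (el-idx _) (cong (el a ∙_) el-y)) ⟩
          (el a ∙ (g ∙ g)) ∙ g      ≡⟨ cong (_∙ g) (comm (el-fixed a) g²-fixed) ⟩
          ((g ∙ g) ∙ el a) ∙ g      ≡⟨ inverseˡ-unique _ _ (begin
            (((g ∙ g) ∙ el a) ∙ g) ∙ (el a ∙ g)   ≡⟨ assoc _ _ _ ⟩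
            ((g ∙ g) ∙ el a) ∙ (g ∙ (el a ∙ g))   ≡⟨ cong (((g ∙ g) ∙ el a) ∙_) (assoc _ _ _) ⟨
            ((g ∙ g) ∙ el a) ∙ ((g ∙ el a) ∙ g)   ≡⟨ cong (λ z → ((g ∙ g) ∙ el a) ∙ (z ∙ g)) (g∙fixed (el-fixed a)) ⟩
            ((g ∙ g) ∙ el a) ∙ ((el a ⁻¹ ∙ g) ∙ g) ≡⟨ cong (((g ∙ g) ∙ el a) ∙_) (assoc _ _ _) ⟩
            ((g ∙ g) ∙ el a) ∙ (el a ⁻¹ ∙ (g ∙ g)) ≡⟨ assoc _ _ _ ⟩
            (g ∙ g) ∙ (el a ∙ (el a ⁻¹ ∙ (g ∙ g))) ≡⟨ cong ((g ∙ g) ∙_) (\\-leftDividesˡ (el a) (g ∙ g)) ⟩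
            (g ∙ g) ∙ (g ∙ g)                     ≡⟨ g⁴≡e ⟩
            e                                     ∎) ⟩
          (el a ∙ g) ⁻¹             ∎

        abstract
          ψ⁻¹ : Fin n → Fin m × Bool
          ψ⁻¹ x with fixed? x
          ... | yes fx = idx fx , false
          -- An unfixed x is (x g⁻¹)g, and x g⁻¹ is fixed as a product of two unfixed elements.
          ... | no  x≢ = idx (unfixed-∙ x≢ g⁻¹-unfixed) , true
            where
            g⁻¹-unfixed : ¬ Fixed (g ⁻¹)
            g⁻¹-unfixed f = g-unfixed (subst Fixed (⁻¹-involutive g) (fixed-⁻¹ f))

          ψ-ψ⁻¹ : ∀ x → ψ (ψ⁻¹ x) ≡ x
          ψ-ψ⁻¹ x with fixed? x
          ... | yes fx = el-idx fx
          ... | no  x≢ = trans (cong (_∙ g) (el-idx _)) (//-rightDividesˡ g x)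

        ψ⁻¹-isIsomorphism : Morphism.GroupMorphisms.IsGroupIsomorphism (rawOf R) (Dic A y) ψ⁻¹
        ψ⁻¹-isIsomorphism = record
          { isGroupMonomorphism = record
            { isGroupHomomorphism = record
              { isMonoidHomomorphism = record
                { isMagmaHomomorphism = record
                  { isRelHomomorphism = record { cong = cong ψ⁻¹ }
                  ; homo = λ x z → ψ-injective _ _ (begin
                      ψ (ψ⁻¹ (x ∙ z))                   ≡⟨ ψ-ψ⁻¹ _ ⟩
                      x ∙ z                             ≡⟨ cong₂ _∙_ (ψ-ψ⁻¹ x) (ψ-ψ⁻¹ z) ⟨
                      ψ (ψ⁻¹ x) ∙ ψ (ψ⁻¹ z)             ≡⟨ ψ-homo (ψ⁻¹ x) (ψ⁻¹ z) ⟨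
                      ψ (dicMul A y (ψ⁻¹ x) (ψ⁻¹ z))    ∎)
                  }
                ; ε-homo = ψ-injective _ _ (trans (ψ-ψ⁻¹ e) (sym (el-idx _)))
                }
              ; ⁻¹-homo = λ x → ψ-injective _ _ (begin
                  ψ (ψ⁻¹ (x ⁻¹))          ≡⟨ ψ-ψ⁻¹ _ ⟩
                  x ⁻¹                    ≡⟨ cong _⁻¹ (ψ-ψ⁻¹ x) ⟨
                  ψ (ψ⁻¹ x) ⁻¹            ≡⟨ ψ-inv (ψ⁻¹ x) ⟨
                  ψ (dicInv A y (ψ⁻¹ x))  ∎)
              }
            ; injective = λ {x} {z} eq → trans (sym (ψ-ψ⁻¹ x)) (trans (cong ψ eq) (ψ-ψ⁻¹ z))
            }
          ; surjective = λ p → ψ p , λ { refl → ψ-injective _ _ (ψ-ψ⁻¹ (ψ p)) }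
          }

      isGenDicyclic : IsGenDicyclic R
      isGenDicyclic = m , A , y , m-even , A-exponent>2 , y≢e , y² , ψ⁻¹ , ψ⁻¹-isIsomorphism

    private
      8B<n : 12 * length movedList < n → 8 * length movedList < n
      8B<n = ≤-<-trans (*-monoˡ-≤ (length movedList) (m≤m+n 8 4))

    -- The cases compare the fixed subgroup with twice the number of moved elements, and then ask
    -- whether every fixed element squares to `e`.
    exceptional-of-few-moved : ∃[ g ] ¬ Fixed g → 12 * length movedList < n →
                               IsGenDicyclic R ⊎ IsAbelianExpGt2 R
    exceptional-of-few-moved (g , g≢) 12B<n with length fixedList ≤? 2 * length movedList
    -- Everything outside the fixed and moved elements is inverted. These exceptions number at most
    -- 3B, and `inverted-everywhere` requires 4·3B < n; hence the constant 12.
    ... | yes F≤2B = inj₂ (inverted⇒abelian (inverted-everywhere (fixedList ++ movedList)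
            (λ x∉ → unmoved-unfixed⇒inverted (x∉ ∘ ∈-++⁺ʳ fixedList) (x∉ ∘ ∈-++⁺ˡ ∘ ∈-fixedList))
            (≤-<-trans 4C≤12B 12B<n)) (g , g≢))
      where
      B : ℕ
      B = length movedList
      4C≤12B : 4 * length (fixedList ++ movedList) ≤ 12 * B
      4C≤12B = subst₂ _≤_ (cong (4 *_) (sym (length-++ fixedList)))
                 (trans (cong (4 *_) (+-comm (2 * B) B)) (sym (*-assoc 4 3 B)))
                 (*-monoʳ-≤ 4 (+-monoˡ-≤ B F≤2B))
    ... | no F≰2B with all? (λ a → fixed? a →-dec (a ∙ a ≟ e))
    -- Fixed elements are their own inverses here, so they are inverted too.
    ...   | yes a²≡e = inj₂ (inverted⇒abelian inverted (g , g≢))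
      where
      inverted : ∀ x → Inverted x
      inverted x with fixed? x
      ... | yes fx = trans fx (inverseˡ-unique x x (a²≡e x fx))
      ... | no  x≢ = unfixed⇒inverted g≢ (8B<n 12B<n) (≰⇒> F≰2B) x≢
    ...   | no ¬a²≡e with ¬∀⟶∃¬ n _ (λ a → fixed? a →-dec (a ∙ a ≟ e)) ¬a²≡e
    ...     | a , ¬fa⇒a²≡e = inj₁ (isGenDicyclic (fixed-comm g≢ B-small)
                (unfixed⇒inverted g≢ B-small F-large) (unfixed-inverts g≢ B-small F-large) g≢
                (decidable-stable (fixed? a) (λ a≢ → ¬fa⇒a²≡e (λ fa → contradiction fa a≢)))
                (λ a²≡e → ¬fa⇒a²≡e (λ _ → a²≡e)))
      where
      B-small : 8 * length movedList < n
      B-small = 8B<n 12B<n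
      F-large : 2 * length movedList < length fixedList
      F-large = ≰⇒> F≰2B

open GroupAutomorphisms

-- Inverse-closed sets as Boolean functions, and toggling of inverse pairs.

module InvariantSubsets where
  open import Algebra.Structures using (IsGroup)
  import Algebra.Properties.Group as GroupProperties
  open import Data.Bool.Properties using (not-involutive; not-¬)
  open import Data.Nat using (_+_; _*_; _^_; _≤_; _<_; NonZero; >-nonZero)
  open import Data.Nat.Properties hiding (_≟_)
  open import Data.Fin.Properties using (_≟_; all?; ¬∀⟶∃¬; toℕ<n)
  open import Data.Fin.Permutation using (_⟨$⟩ʳ_; _⟨$⟩ˡ_) renaming (inverseˡ to permutation-inverseˡ)
  open import Data.Fin.Subset using () renaming (_∈_ to _∈ₛ_)
  open import Data.Vec using (tabulate) renaming (lookup to lookupᵥ)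
  open import Data.Vec.Properties
    using (lookup∘tabulate; tabulate∘lookup; tabulate-cong; []=⇒lookup; lookup⇒[]=)

  true-ext : ∀ {b c} → (b ≡ true → c ≡ true) → (c ≡ true → b ≡ true) → b ≡ c
  true-ext {true}  {_}     f _ = sym (f refl)
  true-ext {false} {true}  _ g = g refl
  true-ext {false} {false} _ _ = refl

  lookup-extensional : ∀ {n} {S T : Subset n} → (∀ x → lookupᵥ S x ≡ lookupᵥ T x) → S ≡ T
  lookup-extensional {S = S} {T} eq =
    trans (sym (tabulate∘lookup S)) (trans (tabulate-cong eq) (tabulate∘lookup T))

  module Counting {n} (R : FinGroup n) where
    open FinGroup R
    open IsGroup isGroup using (assoc; identityˡ; identityʳ; inverseˡ; inverseʳ)
    open GroupProperties (group R)

    Symmetric : Subset n → Set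
    Symmetric S = ∀ x → lookupᵥ S (x ⁻¹) ≡ lookupᵥ S x

    inverseClosed⇒symmetric : ∀ {S} → InverseClosed R S → Symmetric S
    inverseClosed⇒symmetric {S} (closed , _) x = true-ext
      (λ p → subst (λ z → lookupᵥ S z ≡ true) (⁻¹-involutive x) (step p)) step
      where
      step : ∀ {x} → lookupᵥ S x ≡ true → lookupᵥ S (x ⁻¹) ≡ true
      step {x} p = []=⇒lookup (closed x (lookup⇒[]= x S p))

    symmetric⇒inverseClosed : ∀ {S} → Symmetric S → InverseClosed R S
    symmetric⇒inverseClosed {S} sym-S = closed ,
      λ x x∈ → x ⁻¹ , closed x x∈ , sym (⁻¹-involutive x)
      where
      closed : ∀ x → x ∈ₛ S → (x ⁻¹) ∈ₛ S
      closed x x∈ = lookup⇒[]= (x ⁻¹) S (trans (sym-S x) ([]=⇒lookup x∈))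

    infix 4 _∼_
    _∼_ : Fin n → Fin n → Set
    y ∼ x = y ≡ x ⊎ y ≡ x ⁻¹

    _∼?_ : ∀ y x → Dec (y ∼ x)
    y ∼? x = (y ≟ x) ⊎-dec (y ≟ x ⁻¹)

    ∼-⁻¹ : ∀ {x y} → y ∼ x → y ⁻¹ ∼ x
    ∼-⁻¹ (inj₁ refl) = inj₂ refl
    ∼-⁻¹ (inj₂ refl) = inj₁ (⁻¹-involutive _)

    ∼-⁻¹⁻ : ∀ {x y} → y ⁻¹ ∼ x → y ∼ x
    ∼-⁻¹⁻ {x} {y} p = subst (_∼ x) (⁻¹-involutive y) (∼-⁻¹ p)

    toggle : Fin n → Subset n → Subset n
    toggle x S = tabulate λ y → if does (y ∼? x) then not (lookupᵥ S y) else lookupᵥ S y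

    toggle-∼ : ∀ {x y} S → y ∼ x → lookupᵥ (toggle x S) y ≡ not (lookupᵥ S y)
    toggle-∼ {x} {y} S y∼x = trans (lookup∘tabulate _ y)
      (cong (if_then not (lookupᵥ S y) else lookupᵥ S y) (dec-true (y ∼? x) y∼x))

    toggle-≁ : ∀ {x y} S → ¬ (y ∼ x) → lookupᵥ (toggle x S) y ≡ lookupᵥ S y
    toggle-≁ {x} {y} S y≁x = trans (lookup∘tabulate _ y)
      (cong (if_then not (lookupᵥ S y) else lookupᵥ S y) (dec-false (y ∼? x) y≁x))

    toggle-involutive : ∀ x S → toggle x (toggle x S) ≡ S
    toggle-involutive x S = lookup-extensional pointwise
      where
      pointwise : ∀ y → lookupᵥ (toggle x (toggle x S)) y ≡ lookupᵥ S y
      pointwise y with y ∼? x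
      ... | yes y∼x = trans (toggle-∼ (toggle x S) y∼x)
                        (trans (cong not (toggle-∼ S y∼x)) (not-involutive _))
      ... | no  y≁x = trans (toggle-≁ (toggle x S) y≁x) (toggle-≁ S y≁x)

    toggle-injective : ∀ x {S T} → toggle x S ≡ toggle x T → S ≡ T
    toggle-injective x {S} {T} eq =
      trans (sym (toggle-involutive x S)) (trans (cong (toggle x) eq) (toggle-involutive x T))

    toggle-symmetric : ∀ x {S} → Symmetric S → Symmetric (toggle x S)
    toggle-symmetric x {S} sym-S y with y ∼? x
    ... | yes y∼x = trans (toggle-∼ S (∼-⁻¹ y∼x)) (trans (cong not (sym-S y)) (sym (toggle-∼ S y∼x)))
    ... | no  y≁x = trans (toggle-≁ S (y≁x ∘ ∼-⁻¹⁻)) (trans (sym-S y) (sym (toggle-≁ S y≁x)))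

    -- The inverse `θ` is kept as data so that the points which φ sends to x or x⁻¹ can be listed
    -- explicitly.
    record NontrivialStabiliser (S : Subset n) : Set where
      field
        φ θ        : Fin n → Fin n
        homo       : Homomorphic R φ
        θφ         : ∀ x → θ (φ x) ≡ x
        nontrivial : ∃[ g ] ¬ φ g ≡ g
        invariant  : ∀ x → lookupᵥ S (φ x) ≡ lookupᵥ S x
        symmetric  : Symmetric S
    open NontrivialStabiliser

    -- The normalising permutation π is followed by right translation by π(e)⁻¹, so that `e` is
    -- fixed. Normalising `R` makes the result a homomorphism, and it is nontrivial because π is not
    -- itself a translation.
    nontrivialStabiliser : ∀ {S} → InverseClosed R S → NormalizerLarger R S → NontrivialStabiliser S
    nontrivialStabiliser {S} S-closed (π , aut , (normal , _) , π∉R) = record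
      { φ          = λ x → f x ∙ a ⁻¹
      ; θ          = λ x → π ⟨$⟩ˡ (x ∙ a)
      ; homo       = λ x y → trans (cong (_∙ a ⁻¹) (π-homo x y)) (assoc _ _ _)
      ; θφ         = λ x → trans (cong (π ⟨$⟩ˡ_) (//-rightDividesˡ a _)) (permutation-inverseˡ π)
      ; nontrivial = ¬∀⟶∃¬ n _ (λ x → (f x ∙ a ⁻¹) ≟ x) λ φ≡id →
          π∉R (a , λ x → trans (sym (//-rightDividesˡ a _)) (cong (_∙ a) (φ≡id x)))
      -- Only arcs leaving `e` are needed: the arc from e to x expresses x ∈ S, and its image under
      -- π expresses φ(x) ∈ S.
      ; invariant  = λ x → true-ext
          (λ p → []=⇒lookup (subst (_∈ₛ S) (x∙e⁻¹ x) (proj₂ (aut e x) (lookup⇒[]= _ S p))))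
          (λ p → []=⇒lookup (proj₁ (aut e x) (subst (_∈ₛ S) (sym (x∙e⁻¹ x)) (lookup⇒[]= x S p))))
      ; symmetric  = inverseClosed⇒symmetric S-closed
      }
      where
      f : Fin n → Fin n
      f = π ⟨$⟩ʳ_
      a : Fin n
      a = f e
      x∙e⁻¹ : ∀ x → x ∙ e ⁻¹ ≡ x
      x∙e⁻¹ x = trans (cong (x ∙_) ε⁻¹≈ε) (identityʳ x)
      π-homo : ∀ x y → f (x ∙ y) ≡ (f x ∙ a ⁻¹) ∙ f y
      π-homo x y with normal y
      ... | h , πh = begin
        f (x ∙ y)                       ≡⟨ πh x ⟩
        f x ∙ h                         ≡⟨ cong (f x ∙_) (\\-leftDividesʳ a h) ⟨
        f x ∙ (a ⁻¹ ∙ (a ∙ h))          ≡⟨ assoc _ _ _ ⟨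
        (f x ∙ a ⁻¹) ∙ (a ∙ h)          ≡⟨ cong ((f x ∙ a ⁻¹) ∙_) (trans (sym (πh e)) (cong f (identityˡ y))) ⟩
        (f x ∙ a ⁻¹) ∙ f y         ∎
        where open ≡-Reasoning

    -- Equalisers of families of automorphisms.

    Stabilised : Set
    Stabilised = ∃ NontrivialStabiliser

    automorphism : Stabilised → Fin n → Fin n
    automorphism p = φ (proj₂ p)

    Agree : List Stabilised → Fin n → Set
    Agree X y = All (λ p → All (λ q → automorphism p y ≡ automorphism q y) X) X

    agree? : ∀ X → Decidable (Agree X)
    agree? X y = All.all? (λ p → All.all? (λ q → automorphism p y ≟ automorphism q y) X) X

    equaliser : List Stabilised → List (Fin n)
    equaliser X = filter (agree? X) (allFin n)

    agree : ∀ {X y p q} → Agree X y → p ∈ X → q ∈ X → automorphism p y ≡ automorphism q y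
    agree ag p∈ q∈ = All.lookup (All.lookup ag p∈) q∈

    agree-⁻¹∙ : ∀ {X x y} → Agree X y → Agree X (x ∙ y) → Agree X x
    agree-⁻¹∙ {X} {x} {y} ag-y ag-xy = All.tabulate λ {p} p∈ → All.tabulate λ {q} q∈ →
      ∙-cancelʳ (automorphism p y) _ _ (begin
        automorphism p x ∙ automorphism p y  ≡⟨ homo (proj₂ p) x y ⟨
        automorphism p (x ∙ y)               ≡⟨ agree ag-xy p∈ q∈ ⟩
        automorphism q (x ∙ y)               ≡⟨ homo (proj₂ q) x y ⟩
        automorphism q x ∙ automorphism q y  ≡⟨ cong (automorphism q x ∙_) (agree ag-y p∈ q∈) ⟨
        automorphism q x ∙ automorphism p y  ∎)
      where open ≡-Reasoning

    agree-∙ : ∀ {X x y} → Agree X x → Agree X y → Agree X (x ∙ y)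
    agree-∙ {X} {x} {y} ag-x ag-y = All.tabulate λ {p} p∈ → All.tabulate λ {q} q∈ → begin
      automorphism p (x ∙ y)               ≡⟨ homo (proj₂ p) x y ⟩
      automorphism p x ∙ automorphism p y  ≡⟨ cong₂ _∙_ (agree ag-x p∈ q∈) (agree ag-y p∈ q∈) ⟩
      automorphism q x ∙ automorphism q y  ≡⟨ homo (proj₂ q) x y ⟨
      automorphism q (x ∙ y)               ∎
      where open ≡-Reasoning

    module _ (X : List Stabilised) {x : Fin n} (x-disagree : ¬ Agree X x) (v : Fin n) where

      private
        at-x : Stabilised → Fin n
        at-x p = automorphism p x

        X′ : List Stabilised
        X′ = fibre _≟_ at-x v X

        ∈-X′⁻ : ∀ {p} → p ∈ X′ → p ∈ X × at-x p ≡ v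
        ∈-X′⁻ = ∈-filter⁻ (λ p → at-x p ≟ v) {xs = X}

        agree-restrict : ∀ {y} → Agree X y → Agree X′ y
        agree-restrict ag = All.tabulate λ p∈ → All.tabulate λ q∈ →
          agree ag (proj₁ (∈-X′⁻ p∈)) (proj₁ (∈-X′⁻ q∈))

        agree-x : Agree X′ x
        agree-x = All.tabulate λ p∈ → All.tabulate λ q∈ →
          trans (proj₂ (∈-X′⁻ p∈)) (sym (proj₂ (∈-X′⁻ q∈)))

        ∈-equaliser⁻ : ∀ {y} → y ∈ equaliser X → Agree X y
        ∈-equaliser⁻ y∈ = proj₂ (∈-filter⁻ (agree? X) {xs = allFin n} y∈)

      -- The equaliser E is closed under products and x lies outside it, so E and the translate xE
      -- are disjoint. Both lie in the equaliser of the subfamily, whose members share the value `v`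
      -- at x.
      equaliser-doubles : 2 * length (equaliser X) ≤ length (equaliser X′)
      equaliser-doubles = subst (_≤ length (equaliser X′)) length-both
        (unique-⊆⇒length-≤ (Unique.++⁺ u (Unique.map⁺ (∙-cancelˡ x _ _) u) disjoint) both⊆)
        where
        u : Unique (equaliser X)
        u = Unique.filter⁺ (agree? X) (Unique.allFin⁺ n)
        both : List (Fin n)
        both = equaliser X ++ map (x ∙_) (equaliser X)
        length-both : length both ≡ 2 * length (equaliser X)
        length-both = trans (length-++ (equaliser X)) (cong (length (equaliser X) +_)
          (trans (length-map (x ∙_) (equaliser X)) (sym (+-identityʳ _))))
        disjoint : ∀ {y} → ¬ (y ∈ equaliser X × y ∈ map (x ∙_) (equaliser X))
        disjoint (y∈ , y∈′) with ∈-map⁻ (x ∙_) y∈′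
        ... | z , z∈ , refl = x-disagree (agree-⁻¹∙ (∈-equaliser⁻ z∈) (∈-equaliser⁻ y∈))
        both⊆ : ∀ {y} → y ∈ both → y ∈ equaliser X′
        both⊆ {y} y∈ = ∈-filter⁺ (agree? X′) (∈-allFin y) (cases (∈-++⁻ (equaliser X) y∈))
          where
          cases : y ∈ equaliser X ⊎ y ∈ map (x ∙_) (equaliser X) → Agree X′ y
          cases (inj₁ y∈E) = agree-restrict (∈-equaliser⁻ y∈E)
          cases (inj₂ y∈xE) with ∈-map⁻ (x ∙_) y∈xE
          ... | z , z∈ , refl = agree-∙ agree-x (agree-restrict (∈-equaliser⁻ z∈))

    -- Sets invariant under a single automorphism.

    module _ {all : List (Subset n)} (complete : ∀ S → Symmetric S → S ∈ all) where

      module _ (φ : Fin n → Fin n) where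

        -- Toggling x does not affect the equations S(φ y) = S(y) for later y, but breaks the one for x.
        Independent : List (Fin n) → Set
        Independent M = All (λ x → ¬ φ x ∼ x) M × AllPairs (λ x y → ¬ y ∼ x × ¬ φ y ∼ x) M

        InvariantAt : Subset n → Fin n → Set
        InvariantAt S x = lookupᵥ S (φ x) ≡ lookupᵥ S x

        -- Adjoining the toggles at x doubles `L`: toggling changes S at x but not at φ(x), so the
        -- new sets violate the equation at x and are disjoint from the old ones. The equations at
        -- the later points survive, and induction on `M` applies.
        length-*-2^-≤ : ∀ {M} → Independent M → ∀ {L} → Unique L → All Symmetric L →
                        All (λ S → All (InvariantAt S) M) L → length L * 2 ^ length M ≤ length all
        length-*-2^-≤ {[]} _ {L} u sym-L _ = subst (_≤ length all) (sym (*-identityʳ (length L)))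
          (unique-⊆⇒length-≤ u (λ S∈ → complete _ (All.lookup sym-L S∈)))
        length-*-2^-≤ {x ∷ M} (φx≁x ∷ φ≁ , later ∷ indep) {L} u sym-L inv = begin
          length L * (2 * 2 ^ length M)   ≡⟨ *-assoc (length L) 2 _ ⟨
          (length L * 2) * 2 ^ length M   ≡⟨ cong (_* 2 ^ length M) length-L′ ⟨
          length L′ * 2 ^ length M        ≤⟨ length-*-2^-≤ (φ≁ , indep) unique-L′ sym-L′ inv-L′ ⟩
          length all                      ∎
          where
          open ≤-Reasoning
          L′ : List (Subset n)
          L′ = L ++ map (toggle x) L
          length-L′ : length L′ ≡ length L * 2
          length-L′ = trans (length-++ L) (trans (cong (length L +_) (length-map (toggle x) L))
            (trans (cong (length L +_) (sym (+-identityʳ _))) (*-comm 2 (length L))))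
          toggle-inv : ∀ {S} → All (InvariantAt S) (x ∷ M) → All (InvariantAt (toggle x S)) M
          toggle-inv {S} (_ ∷ invS) = All.zipWith
            (λ { (inv-y , y≁x , φy≁x) → trans (toggle-≁ S φy≁x) (trans inv-y (sym (toggle-≁ S y≁x))) })
            (invS , later)
          sym-L′ : All Symmetric L′
          sym-L′ = All.++⁺ sym-L (All.map⁺ (All.map (λ {S} → toggle-symmetric x {S}) sym-L))
          inv-L′ : All (λ S → All (InvariantAt S) M) L′
          inv-L′ = All.++⁺ (All.map All.tail inv) (All.map⁺ (All.map (λ {S} → toggle-inv {S}) inv))
          disjoint : ∀ {S} → ¬ (S ∈ L × S ∈ map (toggle x) L)
          disjoint (S∈ , S∈′) with ∈-map⁻ (toggle x) S∈′
          ... | T , T∈ , refl = not-¬ {lookupᵥ T x} refl (trans (sym (All.head (All.lookup inv T∈)))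
            (trans (sym (toggle-≁ T φx≁x)) (trans (All.head (All.lookup inv S∈)) (toggle-∼ T (inj₁ refl)))))
          unique-L′ : Unique L′
          unique-L′ = Unique.++⁺ u (Unique.map⁺ (toggle-injective x) u) disjoint

        -- Greedy choice: taking x discards only x, x⁻¹ and their preimages under φ, so at least a
        -- quarter of `B` is kept. The bound `k` on the length drives the recursion, since the
        -- filtered list is not a structural subterm.
        independent-sublist : (θ : Fin n → Fin n) → (∀ x → θ (φ x) ≡ x) →
                              ∀ k {B} → length B ≤ k → Unique B → All (λ x → ¬ φ x ∼ x) B →
                              ∃[ M ] Independent M × All (_∈ B) M × length B ≤ 4 * length M
        independent-sublist θ θφ k {[]} _ _ _ = [] , ([] , []) , [] , z≤n
        independent-sublist θ θφ (suc k) {x ∷ B} (s≤s B≤k) u@(_ ∷ uB) (φx≁x ∷ φ≁) =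
          let M , (φ≁M , indep) , M⊆ , C≤4M = independent-sublist θ θφ k {C}
                (≤-trans (length-filter later? B) B≤k) (Unique.filter⁺ later? uB) (All.filter⁺ later? φ≁)
              M⊆′ = All.map (∈-filter⁻ later? {xs = B}) M⊆
          in  x ∷ M ,
              (φx≁x ∷ φ≁M , All.map proj₂ M⊆′ ∷ indep) ,
              here refl ∷ All.map (there ∘ proj₁) M⊆′ ,
              (begin
                length (x ∷ B)              ≤⟨ unique-⊆⇒length-≤ u covered ⟩
                4 + length C                ≤⟨ +-monoʳ-≤ 4 C≤4M ⟩
                4 + 4 * length M            ≡⟨ *-suc 4 (length M) ⟨
                4 * suc (length M)          ∎)
          where
          open ≤-Reasoning
          later? : Decidable (λ y → ¬ y ∼ x × ¬ φ y ∼ x)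
          later? y = ¬? (y ∼? x) ×-dec ¬? (φ y ∼? x)
          C : List (Fin n)
          C = filter later? B
          covered : ∀ {y} → y ∈ x ∷ B → y ∈ x ∷ x ⁻¹ ∷ θ x ∷ θ (x ⁻¹) ∷ C
          covered (here refl) = here refl
          covered {y} (there y∈) with y ∼? x | φ y ∼? x
          ... | yes (inj₁ refl) | _ = here refl
          ... | yes (inj₂ refl) | _ = there (here refl)
          ... | no _   | yes (inj₁ φy≡) = there (there (here (trans (sym (θφ y)) (cong θ φy≡))))
          ... | no _   | yes (inj₂ φy≡) = there (there (there (here (trans (sym (θφ y)) (cong θ φy≡)))))
          ... | no y≁x | no φy≁x = there (there (there (there (∈-filter⁺ later? y∈ (y≁x , φy≁x)))))

      -- The union bound over automorphisms of a non-exceptional group.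

      module _ (¬dicyclic : ¬ IsGenDicyclic R) (¬abelian : ¬ IsAbelianExpGt2 R)
               {m : ℕ} (48m≤n : 48 * m ≤ n) where

        -- At least n/12 elements are moved, and a quarter of them can be made independent, which
        -- yields n/48 ≥ m independent toggles.
        few-invariant : ∀ {S} (α : NontrivialStabiliser S) {L} → Unique L →
                        All (λ T → Symmetric T × (∀ x → InvariantAt (φ α) T x)) L →
                        length L * 2 ^ m ≤ length all
        few-invariant α {L} u inv
          with independent-sublist (φ α) (θ α) (θφ α) _ ≤-refl
                 (Unique.filter⁺ moved? (Unique.allFin⁺ n))
                 (All.tabulate (λ x∈ → proj₂ (∈-filter⁻ moved? {xs = allFin n} x∈)))
          where open Endomorphism R (φ α) (homo α)
        ... | M , indep , _ , B≤4M = begin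
          length L * 2 ^ m         ≤⟨ *-monoʳ-≤ (length L) (^-monoʳ-≤ 2 m≤M) ⟩
          length L * 2 ^ length M  ≤⟨ length-*-2^-≤ (φ α) indep u (All.map proj₁ inv)
                                        (All.map (λ T-inv → All.tabulate (λ {x} _ → proj₂ T-inv x)) inv) ⟩
          length all               ∎
          where
          open ≤-Reasoning
          open Endomorphism R (φ α) (homo α)
          n≤12B : n ≤ 12 * length movedList
          n≤12B = ≮⇒≥ λ 12B<n → [ ¬dicyclic , ¬abelian ]′ (exceptional-of-few-moved (nontrivial α) 12B<n)
          m≤M : m ≤ length M
          m≤M = *-cancelˡ-≤ 48 (begin
            48 * m                   ≤⟨ 48m≤n ⟩
            n                        ≤⟨ n≤12B ⟩
            12 * length movedList    ≤⟨ *-monoʳ-≤ 12 B≤4M ⟩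
            12 * (4 * length M)      ≡⟨ *-assoc 12 4 (length M) ⟨
            48 * length M            ∎)

        private instance
          n-nonZero : NonZero n
          n-nonZero = >-nonZero (≤-<-trans z≤n (toℕ<n e))

        -- Prescribing the common value of the automorphisms at a point outside the equaliser
        -- doubles the equaliser, so after log₂ n such choices the automorphism is determined.
        few-stabilised : ∀ k X → Unique (map proj₁ X) → n < 2 ^ k * length (equaliser X) →
                         length X * 2 ^ m ≤ n ^ k * length all
        few-stabilised k X u n<2^kE with all? (agree? X)
        few-stabilised k []         u n<2^kE | yes _  = z≤n
        -- The equaliser is the whole group, so all members of X carry the same automorphism and
        -- their sets are invariant under that of `p`.
        few-stabilised k X@(p ∷ _)  u n<2^kE | yes ag = begin
          length X * 2 ^ m              ≡⟨ cong (_* 2 ^ m) (length-map proj₁ X) ⟨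
          length (map proj₁ X) * 2 ^ m  ≤⟨ few-invariant (proj₂ p) u (All.map⁺ (All.tabulate p-invariant)) ⟩
          length all                    ≤⟨ m≤n*m (length all) (n ^ k) {{m^n≢0 n k}} ⟩
          n ^ k * length all            ∎
          where
          open ≤-Reasoning
          p-invariant : ∀ {q} → q ∈ X →
                        Symmetric (proj₁ q) × (∀ x → InvariantAt (automorphism p) (proj₁ q) x)
          p-invariant {S , α} q∈ = symmetric α , λ x →
            subst (λ y → lookupᵥ S y ≡ lookupᵥ S x) (agree (ag x) q∈ (here refl)) (invariant α x)
        few-stabilised k X u n<2^kE | no ¬ag with ¬∀⟶∃¬ n _ (agree? X) ¬ag
        -- With no choices left, the hypothesis says that the equaliser has more than n elements.
        few-stabilised zero    X u n<2^kE | no ¬ag | _ = contradiction n<2^kE (≤⇒≯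
          (subst₂ _≤_ (sym (+-identityʳ _)) (length-allFin n) (length-filter (agree? X) (allFin n))))
        few-stabilised (suc k) X u n<2^kE | no ¬ag | x , x-disagree =
          subst (length X * 2 ^ m ≤_)
            (trans (cong (_* (n ^ k * length all)) (length-allFin n)) (sym (*-assoc n (n ^ k) (length all))))
          (length-≤-fibres _≟_ at-x (2 ^ m) (n ^ k * length all) (allFin n) X
            (All.tabulate (λ _ → ∈-allFin _)) λ v →
              few-stabilised k (fibre _≟_ at-x v X)
                (AllPairs.map⁺ (AllPairs.filter⁺ (λ p → at-x p ≟ v) (AllPairs.map⁻ u)))
                (<-≤-trans n<2^kE (begin
                  2 * 2 ^ k * length (equaliser X)     ≡⟨ cong (_* length (equaliser X)) (*-comm 2 (2 ^ k)) ⟩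
                  2 ^ k * 2 * length (equaliser X)     ≡⟨ *-assoc (2 ^ k) 2 _ ⟩
                  2 ^ k * (2 * length (equaliser X))   ≤⟨ *-monoʳ-≤ (2 ^ k) (equaliser-doubles X x-disagree v) ⟩
                  2 ^ k * length (equaliser (fibre _≟_ at-x v X)) ∎)))
          where
          open ≤-Reasoning
          at-x : Stabilised → Fin n
          at-x p = automorphism p x

    -- Each bad set is paired with one automorphism witnessing that it is bad. All these
    -- automorphisms fix `e`, so the initial equaliser is nonempty and n < 2^k suffices to start the
    -- doubling.
    few-bad : ¬ IsGenDicyclic R → ¬ IsAbelianExpGt2 R → ∀ {all bad} →
              EnumeratesInvClosed R all → BadList R bad →
              ∀ k {m} → n < 2 ^ k → 48 * m ≤ n → length bad * 2 ^ m ≤ n ^ k * length all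
    few-bad ¬dic ¬abel {all} {bad} (_ , _ , complete) (u , bad-bad) k {m} n<2^k 48m≤n =
      subst (λ l → l * 2 ^ m ≤ n ^ k * length all) (trans (sym (length-map proj₁ X)) (cong length X-bad))
        (few-stabilised complete′ ¬dic ¬abel {m} 48m≤n k X (subst Unique (sym X-bad) u)
          (<-≤-trans n<2^k (m≤m*n (2 ^ k) _ {{>-nonZero E>0}})))
      where
      complete′ : ∀ S → Symmetric S → S ∈ all
      complete′ S sym-S = complete S (symmetric⇒inverseClosed {S} sym-S)
      stabilised : ∀ {L} → All (λ S → InverseClosed R S × NormalizerLarger R S) L →
                   ∃[ X ] map (proj₁ {B = NontrivialStabiliser}) X ≡ L
      stabilised []                      = [] , refl
      stabilised ((cl , larger) ∷ bads) =
        let X , X≡ = stabilised bads in (_ , nontrivialStabiliser cl larger) ∷ X , cong (_ ∷_) X≡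
      X : List (∃ NontrivialStabiliser)
      X = proj₁ (stabilised bad-bad)
      X-bad : map proj₁ X ≡ bad
      X-bad = proj₂ (stabilised bad-bad)
      E>0 : 0 < length (equaliser X)
      E>0 = ∈-length (∈-filter⁺ (agree? X) (∈-allFin e)
        (All.tabulate λ {p} _ → All.tabulate λ {q} _ →
          trans (Endomorphism.ε-homo R _ (homo (proj₂ p))) (sym (Endomorphism.ε-homo R _ (homo (proj₂ q))))))

open InvariantSubsets

-- Growth estimates and the passage to rational proportions.

open import Data.Integer as ℤ using (+_; -[1+_]; +≤+; +<+)
import Data.Integer.Properties as ℤ
open import Data.Rational using (ℚ; mkℚ; 0ℚ; _<_; _≤_; _*_; _/_; *<*; ↧ₙ_; toℚᵘ)
import Data.Rational.Properties as ℚ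
open import Data.Rational.Unnormalised as ℚᵘ using (mkℚᵘ)
import Data.Rational.Unnormalised.Properties as ℚᵘ

n<2^n : ∀ n → n ℕ.< 2 ℕ.^ n
n<2^n zero    = s≤s z≤n
n<2^n (suc n) = begin-strict
  suc n                      <⟨ s≤s (n<2^n n) ⟩
  1 ℕ.+ 2 ℕ.^ n              ≤⟨ ℕ.+-mono-≤ (ℕ.m^n>0 2 n) (ℕ.m≤m+n (2 ℕ.^ n) 0) ⟩
  2 ℕ.^ suc n                ∎
  where open ℕ.≤-Reasoning

binary-length : ∀ n → ∃[ k ] 2 ℕ.^ k ℕ.≤ suc n × suc n ℕ.< 2 ℕ.^ suc k
binary-length zero    = 0 , s≤s z≤n , s≤s (s≤s z≤n)
binary-length (suc n) with binary-length n
... | k , lo , hi with suc (suc n) ℕ.<? 2 ℕ.^ suc k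
...   | yes below = k , ℕ.m≤n⇒m≤1+n lo , below
...   | no  above = suc k , ℕ.≮⇒≥ above , ℕ.≤-<-trans hi (ℕ.^-monoʳ-< 2 (s≤s (s≤s z≤n)) (ℕ.n<1+n (suc k)))

quadratic≤exponential : ∀ {k} → 14 ℕ.≤′ k → 48 ℕ.* (suc k ℕ.* suc (suc k)) ℕ.≤ 2 ℕ.^ k
-- Here 48·15·16 = 11520 and 2^14 = 16384; the inequality fails at k = 13.
quadratic≤exponential (ℕ.≤′-reflexive refl) = ℕ.≤ᵇ⇒≤ 11520 16384 _
quadratic≤exponential (ℕ.≤′-step {k} 14≤′k) = begin
  48 ℕ.* (suc l ℕ.* suc (suc l))  ≤⟨ ℕ.*-monoʳ-≤ 48 (ℕ.*-monoʳ-≤ (suc l) l+2≤2l) ⟩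
  48 ℕ.* (suc l ℕ.* (2 ℕ.* l))    ≡⟨ solve 1 (λ x → con 48 :* ((con 1 :+ x) :* (con 2 :* x))
                                     := con 2 :* (con 48 :* (x :* (con 1 :+ x)))) refl l ⟩
  2 ℕ.* (48 ℕ.* (l ℕ.* suc l))    ≤⟨ ℕ.*-monoʳ-≤ 2 (quadratic≤exponential 14≤′k) ⟩
  2 ℕ.* 2 ℕ.^ k                   ∎
  where
  open import Data.Nat.Solver using (module +-*-Solver)
  open +-*-Solver using (solve; con; _:*_; _:+_; _:=_)
  open ℕ.≤-Reasoning
  l : ℕ
  l = suc k
  l+2≤2l : suc (suc l) ℕ.≤ 2 ℕ.* l
  l+2≤2l = subst₂ ℕ._≤_ (ℕ.+-comm l 2) (cong (l ℕ.+_) (sym (ℕ.+-identityʳ l)))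
    (ℕ.+-monoʳ-≤ l (s≤s (ℕ.≤-trans (s≤s z≤n) (ℕ.≤′⇒≤ 14≤′k))))

fraction≤ : ∀ ε a b → 0ℚ < ε → ↧ₙ ε ℕ.* b ℕ.≤ a → (+ b) / 1 ≤ ε * ((+ a) / 1)
fraction≤ (mkℚ (+ zero) _ _)   a b (*<* (+<+ ()))
fraction≤ (mkℚ -[1+ _ ] _ _)   a b (*<* ())
fraction≤ ε@(mkℚ (+ suc p) d _) a b _ qb≤a = ℚ.toℚᵘ-cancel-≤ (begin
  toℚᵘ ((+ b) / 1)                  ≃⟨ ℚ.toℚᵘ-fromℚᵘ (mkℚᵘ (+ b) 0) ⟩
  mkℚᵘ (+ b) 0                      ≤⟨ ℚᵘ.*≤* core ⟩
  toℚᵘ ε ℚᵘ.* mkℚᵘ (+ a) 0          ≃⟨ ℚᵘ.*-congˡ {toℚᵘ ε} (ℚ.toℚᵘ-fromℚᵘ (mkℚᵘ (+ a) 0)) ⟨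
  toℚᵘ ε ℚᵘ.* toℚᵘ ((+ a) / 1)      ≃⟨ ℚ.toℚᵘ-homo-* ε ((+ a) / 1) ⟨
  toℚᵘ (ε * ((+ a) / 1))            ∎)
  where
  open ℚᵘ.≤-Reasoning
  core-ℕ : b ℕ.* (suc d ℕ.* 1) ℕ.≤ suc p ℕ.* a ℕ.* 1
  core-ℕ = subst₂ ℕ._≤_
    (trans (ℕ.*-comm (suc d) b) (cong (b ℕ.*_) (sym (ℕ.*-identityʳ (suc d)))))
    (sym (ℕ.*-identityʳ (suc p ℕ.* a)))
    (ℕ.≤-trans qb≤a (ℕ.m≤n*m a (suc p)))
  core : + b ℤ.* + (suc d ℕ.* 1) ℤ.≤ + suc p ℤ.* + a ℤ.* + 1
  core = subst₂ ℤ._≤_ (ℤ.pos-* b (suc d ℕ.* 1))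
    (trans (ℤ.pos-* (suc p ℕ.* a) 1) (cong (ℤ._* + 1) (ℤ.pos-* (suc p) a))) (+≤+ core-ℕ)

theorem1p3 : (ε : ℚ) → 0ℚ < ε →
    ∃[ N ] ((n : ℕ) → n ≥ N → (R : FinGroup n) →
    ¬ IsGenDicyclic R → ¬ IsAbelianExpGt2 R →
    (all bad : List (Subset n)) →
    EnumeratesInvClosed R all → BadList R bad →
    ((+ length bad) / 1) ≤ ε * ((+ length all) / 1))
-- With k the integer part of log₂ n, this threshold forces k ≥ q + 14: the 14 is the range of
-- `quadratic≤exponential`, and the q makes 2^(k+1) exceed the denominator of ε.
theorem1p3 ε ε>0 = 2 ℕ.^ (q ℕ.+ 14) , bound
  where
  q : ℕ
  q = ↧ₙ ε
  bound : (n : ℕ) → n ≥ 2 ℕ.^ (q ℕ.+ 14) → (R : FinGroup n) → ¬ IsGenDicyclic R → ¬ IsAbelianExpGt2 R →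
          (all bad : List (Subset n)) → EnumeratesInvClosed R all → BadList R bad →
          ((+ length bad) / 1) ≤ ε * ((+ length all) / 1)
  bound zero N≤n = contradiction N≤n (ℕ.<⇒≱ (ℕ.m^n>0 2 (q ℕ.+ 14)))
  bound n@(suc n′) N≤n R ¬dic ¬abel all bad enum isBad with binary-length n′
  ... | k , 2^k≤n , n<2^l = fraction≤ ε (length all) (length bad) ε>0 (begin
    q ℕ.* length bad        ≤⟨ ℕ.*-monoˡ-≤ (length bad) q≤2^l ⟩
    2 ℕ.^ l ℕ.* length bad  ≡⟨ ℕ.*-comm (2 ℕ.^ l) (length bad) ⟩
    length bad ℕ.* 2 ℕ.^ l  ≤⟨ ℕ.*-cancelʳ-≤ _ _ (2 ℕ.^ (l ℕ.* l)) {{ℕ.m^n≢0 2 (l ℕ.* l)}} scaled ⟩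
    length all              ∎)
    where
    open ℕ.≤-Reasoning
    l : ℕ
    l = suc k
    q+14≤k : q ℕ.+ 14 ℕ.≤ k
    q+14≤k = ℕ.≮⇒≥ λ k<q+14 → ℕ.<-irrefl refl
      (ℕ.<-≤-trans n<2^l (ℕ.≤-trans (ℕ.^-monoʳ-≤ 2 k<q+14) N≤n))
    q≤2^l : q ℕ.≤ 2 ℕ.^ l
    q≤2^l = ℕ.≤-trans (ℕ.≤-trans (ℕ.m≤m+n q 14) (ℕ.m≤n⇒m≤1+n q+14≤k)) (ℕ.<⇒≤ (n<2^n l))
    -- The exponent is m = l + l²: the factor 2^(l²) absorbs the n^l choices of automorphism values,
    -- since n < 2^l, and the remaining 2^l absorbs q.
    48m≤n : 48 ℕ.* (l ℕ.+ l ℕ.* l) ℕ.≤ n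
    48m≤n = begin
      48 ℕ.* (l ℕ.+ l ℕ.* l)  ≡⟨ cong (48 ℕ.*_) (ℕ.*-suc l l) ⟨
      48 ℕ.* (l ℕ.* suc l)    ≤⟨ quadratic≤exponential {k} (ℕ.≤⇒≤′ (ℕ.≤-trans (ℕ.m≤n+m 14 q) q+14≤k)) ⟩
      2 ℕ.^ k                 ≤⟨ 2^k≤n ⟩
      n                       ∎
    scaled : length bad ℕ.* 2 ℕ.^ l ℕ.* 2 ℕ.^ (l ℕ.* l) ℕ.≤ length all ℕ.* 2 ℕ.^ (l ℕ.* l)
    scaled = begin
      length bad ℕ.* 2 ℕ.^ l ℕ.* 2 ℕ.^ (l ℕ.* l)    ≡⟨ ℕ.*-assoc (length bad) _ _ ⟩
      length bad ℕ.* (2 ℕ.^ l ℕ.* 2 ℕ.^ (l ℕ.* l))  ≡⟨ cong (length bad ℕ.*_) (ℕ.^-distribˡ-+-* 2 l (l ℕ.* l)) ⟨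
      length bad ℕ.* 2 ℕ.^ (l ℕ.+ l ℕ.* l)          ≤⟨ Counting.few-bad R ¬dic ¬abel enum isBad l n<2^l 48m≤n ⟩
      n ℕ.^ l ℕ.* length all                        ≤⟨ ℕ.*-monoˡ-≤ (length all) (ℕ.^-monoˡ-≤ l (ℕ.<⇒≤ n<2^l)) ⟩
      (2 ℕ.^ l) ℕ.^ l ℕ.* length all                ≡⟨ cong (ℕ._* length all) (ℕ.^-*-assoc 2 l l) ⟩
      2 ℕ.^ (l ℕ.* l) ℕ.* length all                ≡⟨ ℕ.*-comm (2 ℕ.^ (l ℕ.* l)) (length all) ⟩
      length all ℕ.* 2 ℕ.^ (l ℕ.* l)                ∎
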